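{- Let $n$ be a positive integer and $a,b$ positive integers. Suppose that there exists a set of $f$ mutually Type~II weakly unbiased Hadamard matrices of order $n$ such that $\sigma(H,K)=\{2a,2b\}$ for any two distinct members $H,K$. Then: (i) $f\le\Big\lfloor\frac{n^4-10n^3+55n^2-110n+184}{5!}\Big\rfloor$; (ii) if $15n^2-30n+16-4(3n-2)(a^2+b^2)+16a^2b^2>0$ and $5(n-2)-2a^2-2b^2\ge0$, then \[ f\le\Big\lfloor\frac{(n^2-4a^2)(n^2-4b^2)}{15n^2-30n+16-4(3n-2)(a^2+b^2)+16a^2b^2}\Big\rfloor . \]
   Context: A Hadamard matrix of order $n$ is an $n\times n$ $(\pm1)$-matrix $H$ with $HH^T=nI_n$. For Hadamard matrices $H,K$ with $a_{ij}$ the $(i,j)$-entry of $HK^T$, $\sigma(H,K)=\{|a_{ij}|: i,j\}$. $H,K$ are Type~II weakly unbiased if $a_{ij}\equiv0\pmod4$ for all $i,j$ and $|\sigma(H,K)|\le 2$, unbiased pairs (all $|a_{ij}|=\sqrt n$) being excluded. A set is mutually Type~II weakly unbiased if every pair of distinct members is Type~II weakly unbiased. -}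

module Defs where

open import Data.Nat as ℕ using (ℕ; zero; suc)
open import Data.Integer as ℤ using (ℤ; +_; -[1+_]; _*_; _+_; ∣_∣; _/ℕ_)
open import Data.Integer.Divisibility as ℤD using ()
open import Data.Fin using (Fin; zero; suc)
open import Data.Product using (Σ; ∃; _×_; _,_)
open import Data.Sum using (_⊎_)
open import Relation.Binary.PropositionalEquality using (_≡_; _≢_)
open import Relation.Nullary using (¬_)
open import Function.Bundles using (_⇔_)

Matrix : ℕ → Set
Matrix n = Fin n → Fin n → ℤ

∑ : ∀ {n} → (Fin n → ℤ) → ℤ
∑ {zero}  f = + 0
∑ {suc n} f = f zero + ∑ (λ k → f (suc k))

prodT : ∀ {n} → Matrix n → Matrix n → Fin n → Fin n → ℤ
prodT H K i j = ∑ (λ k → H i k * K j k)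

nδ : ∀ {n} → Fin n → Fin n → ℤ
nδ {n} i j with i Data.Fin.≟ j
... | Relation.Nullary.yes _ = + n
... | Relation.Nullary.no _  = + 0

IsHadamard : (n : ℕ) → Matrix n → Set
IsHadamard n H =
  (∀ i j → (H i j ≡ + 1) ⊎ (H i j ≡ -[1+ 0 ])) ×
  (∀ i j → prodT H H i j ≡ nδ i j)

_∈σ[_,_] : ∀ {n} → ℕ → Matrix n → Matrix n → Set
x ∈σ[ H , K ] = ∃ λ i → ∃ λ j → ∣ prodT H K i j ∣ ≡ x

σ≤2 : ∀ {n} → Matrix n → Matrix n → Set
σ≤2 H K = ∃ λ x → ∃ λ y → ∀ z → z ∈σ[ H , K ] → (z ≡ x) ⊎ (z ≡ y)

-- H, K unbiased: all |a_ij| = √n, i.e. |a_ij|^2 = n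
Unbiased : (n : ℕ) → Matrix n → Matrix n → Set
Unbiased n H K = ∀ i j → ∣ prodT H K i j ∣ ℕ.* ∣ prodT H K i j ∣ ≡ n

TypeIIWU : (n : ℕ) → Matrix n → Matrix n → Set
TypeIIWU n H K =
  (∀ i j → (+ 4) ℤD.∣ prodT H K i j) ×
  σ≤2 H K ×
  ¬ Unbiased n H K

σ≡[_,_] : ∀ {n} → Matrix n → Matrix n → ℕ → ℕ → Set
σ≡[ H , K ] x y = ∀ z → (z ∈σ[ H , K ]) ⇔ ((z ≡ x) ⊎ (z ≡ y))

-- floor division ⌊N / D⌋ for a positive integer D (junk value 0 if D ≤ 0)
⌊_/_⌋ : ℤ → ℤ → ℤ
⌊ N / + suc d ⌋ = N /ℕ suc d
⌊ N / + zero ⌋ = + 0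
⌊ N / -[1+ d ] ⌋ = + 0

{-# OPTIONS --safe #-}
module Submission where

-- For sign vectors x and y, the odd quintic t (t² − 4a²) (t² − 4b²) in t = ⟨x , y⟩ equals
-- 120 e₅ + 12 s e₃ + D e₁, where e_k is the k-th elementary symmetric function of the entrywise
-- product of x and y, s = 5(n − 2) − 2a² − 2b² and D is the denominator in (ii). It vanishes on
-- distinct rows of the whole family, while each e_k is a Gram kernel on C(n,k) monomials. Hence, for
-- weights v on the N = f n rows, its value at n times ∑ v² is 120 Q₅ + 12 s Q₃ + D Q₁ with every Q_k
-- a sum of C(n,k) squares of linear forms in v. If N > C(n,1) + C(n,3) + C(n,5), some nonzero v kills
-- all these forms, which is absurd; this is (i). For (ii), take v to be the first coordinate of
-- the rows: then ∑ v² = N and Q₁ ≥ N².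

open import Defs
open import Algebra.Properties.Semiring.Sum using ()
open import Data.Fin as Fin using (Fin; zero; suc; splitAt; _↑ˡ_; _↑ʳ_; punchIn; punchOut)
open import Data.Fin.Properties using (all?; ¬∀⟶∃¬; punchIn-punchOut; punchInᵢ≢i; combine-remQuot)
open import Data.Integer using (ℤ; +_; -_; -[1+_]; +[1+_]; _+_; _-_; _*_; _^_; _≤_; _<_; 0ℤ; 1ℤ; ∣_∣; _≟_;
  nonNegative; Positive; +≤+; +<+)
open import Data.Integer.Properties
open import Data.Integer.Tactic.RingSolver using (solve-∀)
open import Data.Nat using (ℕ; zero; suc; NonZero)
import Data.Nat as ℕ
open import Data.Nat.DivMod using (m*n/n≡m; /-monoˡ-≤)
import Data.Nat.Properties as ℕ
open import Data.Product using (∃; _×_; _,_)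
open import Data.Sum using (_⊎_; inj₁; inj₂; [_,_])
open import Data.Sum.Properties using ([,]-map)
open import Data.Vec.Functional using (Vector; map; tail; _++_; _∷_; removeAt; zipWith)
open import Data.Vec.Functional.Properties using (lookup-++ˡ; lookup-++ʳ)
open import Function using (_∘_; id)
open import Function.Bundles using (Equivalence)
open import Relation.Binary.PropositionalEquality using (_≡_; _≢_; refl; sym; trans; cong; cong₂; subst; subst₂)
open import Relation.Nullary using (¬_; yes; no; contradiction)

open Algebra.Properties.Semiring.Sum +-*-semiring
open ≤-Reasoning

-- Sums and sums of squares over the integers.

sum≡0 : ∀ {n} (f : Vector ℤ n) → (∀ i → f i ≡ 0ℤ) → sum f ≡ 0ℤ
sum≡0 {n} f f≡0 = trans (sum-cong-≗ f≡0) (sum-replicate-zero n)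

sum-linear : ∀ {n} x y (f g : Vector ℤ n) →
             sum (λ i → x * f i + y * g i) ≡ x * sum f + y * sum g
sum-linear x y f g = trans (∑-distrib-+ (λ i → x * f i) (λ i → y * g i))
  (cong₂ _+_ (sym (*-distribˡ-sum x f)) (sym (*-distribˡ-sum y g)))

sum-* : ∀ {m n} (f : Vector ℤ m) (g : Vector ℤ n) →
        sum f * sum g ≡ sum (λ i → sum (λ j → f i * g j))
sum-* f g = trans (*-distribʳ-sum (sum g) f) (sum-cong-≗ λ i → *-distribˡ-sum (f i) g)

sum-single : ∀ {n} (f : Vector ℤ n) p → (∀ q → q ≢ p → f q ≡ 0ℤ) → sum f ≡ f p
sum-single {suc n} f p f≡0 = begin-equality
  sum f                        ≡⟨ sum-remove {i = p} f ⟩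
  f p + sum (removeAt f p)     ≡⟨ cong (_+_ (f p)) (sum≡0 (removeAt f p) λ i → f≡0 (punchIn p i) (punchInᵢ≢i p i)) ⟩
  f p + 0ℤ                     ≡⟨ +-identityʳ (f p) ⟩
  f p                          ∎

sum-++ : ∀ {m n} (f : Vector ℤ m) (g : Vector ℤ n) → sum (f ++ g) ≡ sum f + sum g
sum-++ {zero}  f g = sym (+-identityˡ (sum g))
sum-++ {suc m} f g = begin-equality
  f zero + sum (λ i → (f ++ g) (suc i))   ≡⟨ cong (_+_ (f zero)) (sum-cong-≗ λ i → [,]-map (splitAt m i)) ⟩
  f zero + sum (tail f ++ g)              ≡⟨ cong (_+_ (f zero)) (sum-++ (tail f) g) ⟩
  f zero + (sum (tail f) + sum g)         ≡⟨ sym (+-assoc (f zero) (sum (tail f)) (sum g)) ⟩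
  f zero + sum (tail f) + sum g           ∎

0≤i*i : ∀ i → 0ℤ ≤ i * i
0≤i*i (+ n)    = subst (0ℤ ≤_) (pos-* n n) (+≤+ ℕ.z≤n)
0≤i*i -[1+ n ] = +≤+ ℕ.z≤n

0≤sum-sq : ∀ {n} (f : Vector ℤ n) → 0ℤ ≤ sum (λ i → f i * f i)
0≤sum-sq {zero}  f = ≤-refl
0≤sum-sq {suc n} f = +-mono-≤ (0≤i*i (f zero)) (0≤sum-sq (tail f))

sq≤sum-sq : ∀ {n} (f : Vector ℤ n) p → f p * f p ≤ sum (λ i → f i * f i)
sq≤sum-sq f zero = ≤-trans (≤-reflexive (sym (+-identityʳ _))) (+-monoʳ-≤ (f zero * f zero) (0≤sum-sq (tail f)))
sq≤sum-sq f (suc p) = ≤-trans (≤-reflexive (sym (+-identityˡ _))) (+-mono-≤ (0≤i*i (f zero)) (sq≤sum-sq (tail f) p))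

sum-sq≡0 : ∀ {n} (f : Vector ℤ n) → sum (λ i → f i * f i) ≡ 0ℤ → ∀ p → f p ≡ 0ℤ
sum-sq≡0 f eq p = [ id , id ] (i*j≡0⇒i≡0∨j≡0 (f p)
  (≤-antisym (≤-trans (sq≤sum-sq f p) (≤-reflexive eq)) (0≤i*i (f p))))

-- Linear dependence over the integers.

-- Fraction-free Gaussian elimination: the first vector, if nonzero at q, clears coordinate q of the others.
linear-dependence : ∀ {d m} → d ℕ.< m → (v : Fin m → Vector ℤ d) →
                    ∃ λ (c : Vector ℤ m) → (∃ λ p → c p ≢ 0ℤ) × (∀ S → sum (λ p → c p * v p S) ≡ 0ℤ)
linear-dependence {zero}  {suc m} _ v = (λ _ → 1ℤ) , (zero , λ ()) , λ ()
linear-dependence {suc d} {suc m} (ℕ.s≤s d<m) v with all? (λ S → v zero S ≟ 0ℤ)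
... | yes v₀≡0 = 1ℤ ∷ (λ _ → 0ℤ) , (zero , λ ()) ,
  λ S → cong₂ _+_ (trans (*-identityˡ _) (v₀≡0 S)) (sum≡0 (λ j → 0ℤ * v (suc j) S) λ j → *-zeroˡ (v (suc j) S))
... | no ¬v₀≡0 with ¬∀⟶∃¬ _ (λ S → v zero S ≡ 0ℤ) (λ S → v zero S ≟ 0ℤ) ¬v₀≡0
... | q , v₀q≢0
    with linear-dependence d<m (λ j r → v zero q * v (suc j) (punchIn q r) + - v (suc j) q * v zero (punchIn q r))
... | c , (p , cp≢0) , cw≡0 = c′ , (suc p , c′p≢0) , c′v≡0
  where
  α : Vector ℤ (suc d)
  α S = sum (λ j → c j * v (suc j) S)

  -- The coefficient of the pivot vector is forced by coordinate `q`, where the others, scaled by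
  -- the pivot, contribute `v zero q * α q`.
  c′ : Vector ℤ (suc m)
  c′ = - α q ∷ (λ j → v zero q * c j)

  c′p≢0 : v zero q * c p ≢ 0ℤ
  c′p≢0 eq = [ v₀q≢0 , cp≢0 ] (i*j≡0⇒i≡0∨j≡0 (v zero q) eq)

  combination : ∀ S → sum (λ j → c′ j * v j S) ≡ v zero q * α S + - v zero S * α q
  combination S = begin-equality
    - α q * v zero S + sum (λ j → v zero q * c j * v (suc j) S)
      ≡⟨ cong (_+_ (- α q * v zero S)) (sum-cong-≗ λ j → *-assoc (v zero q) (c j) (v (suc j) S)) ⟩
    - α q * v zero S + sum (λ j → v zero q * (c j * v (suc j) S))
      ≡⟨ cong (_+_ (- α q * v zero S)) (sym (*-distribˡ-sum (v zero q) (λ j → c j * v (suc j) S))) ⟩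
    - α q * v zero S + v zero q * α S
      ≡⟨ ring (α q) (v zero S) (v zero q) (α S) ⟩
    v zero q * α S + - v zero S * α q ∎
    where
    ring : ∀ x y z w → - x * y + z * w ≡ z * w + - y * x
    ring = solve-∀

  at-q : ∀ x y → x * y + - x * y ≡ 0ℤ
  at-q = solve-∀

  c′v≡0 : ∀ S → sum (λ j → c′ j * v j S) ≡ 0ℤ
  c′v≡0 S with q Fin.≟ S
  ... | yes refl = trans (combination q) (at-q (v zero q) (α q))
  ... | no q≢S = begin-equality
    sum (λ j → c′ j * v j S)          ≡⟨ combination S ⟩
    v zero q * α S + - v zero S * α q
      ≡⟨ sym (sum-linear (v zero q) (- v zero S) (λ j → c j * v (suc j) S) (λ j → c j * v (suc j) q)) ⟩
    sum (λ j → v zero q * (c j * v (suc j) S) + - v zero S * (c j * v (suc j) q))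
      ≡⟨ sum-cong-≗ (λ j → ring (v zero q) (c j) (v (suc j) S) (v zero S) (v (suc j) q)) ⟩
    sum (λ j → c j * (v zero q * v (suc j) S + - v (suc j) q * v zero S))
      ≡⟨ sum-cong-≗ (λ j → cong (λ R → c j * (v zero q * v (suc j) R + - v (suc j) q * v zero R))
           (sym (punchIn-punchOut q≢S))) ⟩
    sum (λ j → c j * (v zero q * v (suc j) (punchIn q r) + - v (suc j) q * v zero (punchIn q r)))
      ≡⟨ cw≡0 r ⟩
    0ℤ ∎
    where
    r = punchOut q≢S
    ring : ∀ x c y z w → x * (c * y) + - z * (c * w) ≡ c * (x * y + - w * z)
    ring = solve-∀

-- Monomials and elementary symmetric functions of sign vectors.

IsSign : ∀ {n} → Vector ℤ n → Set
IsSign x = ∀ i → x i * x i ≡ 1ℤ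

choose : ℕ → ℕ → ℕ
choose _       zero    = 1
choose zero    (suc k) = 0
choose (suc n) (suc k) = choose n k ℕ.+ choose n (suc k)

-- The products of the entries of x over the k-subsets of the coordinates.
monomials : ∀ {n} k → Vector ℤ n → Vector ℤ (choose n k)
monomials         zero    x _ = 1ℤ
monomials {suc n} (suc k) x   = map (x zero *_) (monomials k (tail x)) ++ monomials (suc k) (tail x)

infixl 7 _⊙_
_⊙_ : ∀ {n} → Vector ℤ n → Vector ℤ n → Vector ℤ n
_⊙_ = zipWith _*_

-- Multiplicativity is what makes `esym k (x ⊙ y)` an inner product of monomial vectors, that is, a
-- Gram kernel.
monomials-⊙ : ∀ {n} k (x y : Vector ℤ n) S → monomials k (x ⊙ y) S ≡ monomials k x S * monomials k y S
monomials-⊙         zero    x y S = refl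
monomials-⊙ {suc n} (suc k) x y S with splitAt (choose n k) S
... | inj₂ R = monomials-⊙ (suc k) (tail x) (tail y) R
... | inj₁ R = trans (cong (x zero * y zero *_) (monomials-⊙ k (tail x) (tail y) R))
                     (ring (x zero) (y zero) (monomials k (tail x) R) (monomials k (tail y) R))
  where
  ring : ∀ a b c d → a * b * (c * d) ≡ a * c * (b * d)
  ring = solve-∀

esym : ∀ {n} → ℕ → Vector ℤ n → ℤ
esym k x = sum (monomials k x)

esym-suc : ∀ {n} k (x : Vector ℤ (suc n)) →
           esym (suc k) x ≡ x zero * esym k (tail x) + esym (suc k) (tail x)
esym-suc k x = trans (sum-++ (map (x zero *_) (monomials k (tail x))) (monomials (suc k) (tail x)))
  (cong (_+ esym (suc k) (tail x)) (sym (*-distribˡ-sum (x zero) (monomials k (tail x)))))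

esym-1 : ∀ {n} (x : Vector ℤ n) → esym 1 x ≡ sum x
esym-1 {zero}  x = refl
esym-1 {suc n} x = trans (esym-suc 0 x) (cong₂ _+_ (*-identityʳ (x zero)) (esym-1 (tail x)))

-- Induction step for a vector with head `x` and tail of length `n` and sum `t`; `e₋`, `e₀`, `e₁`,
-- `e₂` stand for the symmetric functions of the tail in degrees `k - 1` to `k + 2`. The hypothesis
-- `x * x ≡ 1ℤ` enters once, on the term `e₀`.
recurrence-step : ∀ x t e₋ e₀ e₁ e₂ k n → x * x ≡ 1ℤ →
  (+ 2 + k) * e₂ + (n - k) * e₀ ≡ t * e₁ →
  (1ℤ + k) * e₁ + (n - (k - 1ℤ)) * e₋ ≡ t * e₀ →
  (+ 2 + k) * (x * e₁ + e₂) + (1ℤ + n - k) * (x * e₋ + e₀) ≡ (x + t) * (x * e₀ + e₁)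
recurrence-step x t e₋ e₀ e₁ e₂ k n x² eq₁ eq₀ = begin-equality
  (+ 2 + k) * (x * e₁ + e₂) + (1ℤ + n - k) * (x * e₋ + e₀)
    ≡⟨ ring₁ x e₋ e₀ e₁ e₂ k n ⟩
  1ℤ * e₀ + x * e₁ + x * ((1ℤ + k) * e₁ + (n - (k - 1ℤ)) * e₋) + ((+ 2 + k) * e₂ + (n - k) * e₀)
    ≡⟨ cong₂ _+_ (cong₂ (λ u w → u * e₀ + x * e₁ + x * w) (sym x²) eq₀) eq₁ ⟩
  x * x * e₀ + x * e₁ + x * (t * e₀) + t * e₁
    ≡⟨ ring₂ x t e₀ e₁ ⟩
  (x + t) * (x * e₀ + e₁) ∎
  where
  ring₁ : ∀ x e₋ e₀ e₁ e₂ k n → (+ 2 + k) * (x * e₁ + e₂) + (1ℤ + n - k) * (x * e₋ + e₀) ≡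
    1ℤ * e₀ + x * e₁ + x * ((1ℤ + k) * e₁ + (n - (k - 1ℤ)) * e₋) + ((+ 2 + k) * e₂ + (n - k) * e₀)
  ring₁ = solve-∀
  ring₂ : ∀ x t e₀ e₁ → x * x * e₀ + x * e₁ + x * (t * e₀) + t * e₁ ≡ (x + t) * (x * e₀ + e₁)
  ring₂ = solve-∀

-- With t the sum of a sign vector, these are the Krawtchouk polynomials in t, and this is their three-term recurrence.
esym-recurrence : ∀ {n} k (z : Vector ℤ n) → IsSign z →
                  (+ 2 + + k) * esym (2 ℕ.+ k) z + (+ n - + k) * esym k z ≡ sum z * esym (suc k) z
esym-recurrence {zero} zero    z z² = refl
esym-recurrence {zero} (suc k) z z² =
  cong₂ _+_ (*-zeroʳ (+ 2 + + suc k)) (*-zeroʳ (+ 0 - + suc k))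
esym-recurrence {suc n} zero z z² = begin-equality
  + 2 * esym 2 z + (+ suc n - 0ℤ) * 1ℤ
    ≡⟨ cong₂ (λ e u → + 2 * e + (+ suc n - 0ℤ) * u) (esym-suc 1 z) (cong (_+ 1ℤ) (sym (*-zeroʳ x))) ⟩
  + 2 * (x * esym 1 z′ + esym 2 z′) + (+ suc n - 0ℤ) * (x * 0ℤ + 1ℤ)
    ≡⟨ recurrence-step x (sum z′) 0ℤ 1ℤ (esym 1 z′) (esym 2 z′) 0ℤ (+ n) (z² zero)
         (esym-recurrence 0 z′ (z² ∘ suc)) before-first ⟩
  sum z * (x * 1ℤ + esym 1 z′)
    ≡⟨ cong (_*_ (sum z)) (sym (esym-suc 0 z)) ⟩
  sum z * esym 1 z ∎
  where
  x  = z zero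
  z′ = tail z
  -- In the lowest degree the step also calls for the recurrence at index -1. With the symmetric
  -- function of degree -1 read as `0ℤ`, it says that `esym 1` is the sum.
  before-first : 1ℤ * esym 1 z′ + (+ n - (0ℤ - 1ℤ)) * 0ℤ ≡ sum z′ * 1ℤ
  before-first = trans (cong₂ _+_ (*-identityˡ (esym 1 z′)) (*-zeroʳ (+ n - (0ℤ - 1ℤ))))
    (trans (+-identityʳ (esym 1 z′)) (trans (esym-1 z′) (sym (*-identityʳ (sum z′)))))
esym-recurrence {suc n} (suc k) z z² = begin-equality
  (+ 2 + + suc k) * esym (3 ℕ.+ k) z + (+ suc n - + suc k) * esym (suc k) z
    ≡⟨ cong₂ (λ u w → (+ 2 + + suc k) * u + (+ suc n - + suc k) * w) (esym-suc (2 ℕ.+ k) z) (esym-suc k z) ⟩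
  (+ 2 + + suc k) * (x * e₂ + esym (3 ℕ.+ k) z′) + (+ suc n - + suc k) * (x * esym k z′ + e₁)
    ≡⟨ recurrence-step x (sum z′) (esym k z′) e₁ e₂ (esym (3 ℕ.+ k) z′) (+ suc k) (+ n) (z² zero)
         (esym-recurrence (suc k) z′ (z² ∘ suc)) (esym-recurrence k z′ (z² ∘ suc)) ⟩
  sum z * (x * e₁ + e₂)
    ≡⟨ cong (_*_ (sum z)) (sym (esym-suc (suc k) z)) ⟩
  sum z * esym (2 ℕ.+ k) z ∎
  where
  x  = z zero
  z′ = tail z
  e₁ = esym (suc k) z′
  e₂ = esym (2 ℕ.+ k) z′

-- Expansion of the quintic in elementary symmetric functions.

quintic : ℤ → ℤ → ℤ → ℤ
quintic a b t = t * ((t * t - + 4 * (a * a)) * (t * t - + 4 * (b * b)))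

slack : ℤ → ℤ → ℤ → ℤ
slack n a b = + 5 * (n - + 2) - + 2 * (a * a) - + 2 * (b * b)

denominator : ℤ → ℤ → ℤ → ℤ
denominator n a b = + 15 * (n * n) - + 30 * n + + 16 - + 4 * (+ 3 * n - + 2) * (a * a + b * b) + + 16 * (a * a) * (b * b)

-- An equation modulo four relations is certified by one ring identity in which the residual of each
-- relation carries an explicit multiplier; this lemma then removes the residuals.
subtract-zeros : ∀ x c₂ c₃ c₄ c₅ {r₂ r₃ r₄ r₅} → r₂ ≡ 0ℤ → r₃ ≡ 0ℤ → r₄ ≡ 0ℤ → r₅ ≡ 0ℤ →
                 x - (c₂ * r₂ + c₃ * r₃ + c₄ * r₄ + c₅ * r₅) ≡ x
subtract-zeros x c₂ c₃ c₄ c₅ refl refl refl refl = ring x c₂ c₃ c₄ c₅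
  where
  ring : ∀ x c₂ c₃ c₄ c₅ → x - (c₂ * 0ℤ + c₃ * 0ℤ + c₄ * 0ℤ + c₅ * 0ℤ) ≡ x
  ring = solve-∀

quintic-expansion : ∀ {n} a b (z : Vector ℤ n) → IsSign z →
  quintic a b (sum z) ≡ + 120 * esym 5 z + (+ 12 * slack (+ n) a b * esym 3 z + denominator (+ n) a b * esym 1 z)
quintic-expansion {n} a b z z² = begin-equality
  quintic a b t
    ≡⟨ ring a b t (+ n) (esym 2 z) (esym 3 z) (esym 4 z) (esym 5 z) ⟩
  expansion t - (c₂ * residual 0 (esym 2 z) 1ℤ t + c₃ * residual 1 (esym 3 z) t (esym 2 z)
    + c₄ * residual 2 (esym 4 z) (esym 2 z) (esym 3 z) + c₅ * residual 3 (esym 5 z) (esym 3 z) (esym 4 z))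
    ≡⟨ subtract-zeros (expansion t) c₂ c₃ c₄ c₅
         -- The certificate uses `t` for the first symmetric function, while `residual≡0` produces
         -- `esym 1 z`; hence the conversions in the two lowest relations.
         (trans (cong (residual 0 (esym 2 z) 1ℤ) (sym (esym-1 z))) (residual≡0 0))
         (trans (cong (λ e → residual 1 (esym 3 z) e (esym 2 z)) (sym (esym-1 z))) (residual≡0 1))
         (residual≡0 2) (residual≡0 3) ⟩
  expansion t
    ≡⟨ cong expansion (sym (esym-1 z)) ⟩
  expansion (esym 1 z) ∎
  where
  t : ℤ
  t = sum z

  expansion : ℤ → ℤ
  expansion e₁ = + 120 * esym 5 z + (+ 12 * slack (+ n) a b * esym 3 z + denominator (+ n) a b * e₁)

  residual : ℕ → ℤ → ℤ → ℤ → ℤ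
  residual k e₂ e₀ e₁ = (+ 2 + + k) * e₂ + (+ n - + k) * e₀ - t * e₁

  residual≡0 : ∀ k → residual k (esym (2 ℕ.+ k) z) (esym k z) (esym (suc k) z) ≡ 0ℤ
  residual≡0 k = i≡j⇒i-j≡0 (esym-recurrence k z z²)

  -- The multipliers that eliminate e₅, e₄, e₃ and e₂, in this order, from the expansion.
  c₂ c₃ c₄ c₅ : ℤ
  c₂ = t * (t * t + (+ 3 * + n - + 2 - + 4 * (a * a + b * b)))
  c₃ = + 2 * (t * t) + (+ 12 * + n - + 16 - + 8 * (a * a + b * b))
  c₄ = + 6 * t
  c₅ = + 24

  ring : ∀ a b t n e₂ e₃ e₄ e₅ →
    t * ((t * t - + 4 * (a * a)) * (t * t - + 4 * (b * b))) ≡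
    + 120 * e₅ + (+ 12 * (+ 5 * (n - + 2) - + 2 * (a * a) - + 2 * (b * b)) * e₃ +
      (+ 15 * (n * n) - + 30 * n + + 16 - + 4 * (+ 3 * n - + 2) * (a * a + b * b) + + 16 * (a * a) * (b * b)) * t)
    - (t * (t * t + (+ 3 * n - + 2 - + 4 * (a * a + b * b))) * (+ 2 * e₂ + (n - 0ℤ) * 1ℤ - t * t)
      + (+ 2 * (t * t) + (+ 12 * n - + 16 - + 8 * (a * a + b * b))) * (+ 3 * e₃ + (n - 1ℤ) * t - t * e₂)
      + + 6 * t * (+ 4 * e₄ + (n - + 2) * e₂ - t * e₃)
      + + 24 * (+ 5 * e₅ + (n - + 3) * e₃ - t * e₄))
  ring = solve-∀

-- Gram kernels and the energy identity.

sum₂-linear : ∀ {m n} x y (f g : Fin m → Vector ℤ n) →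
  sum (λ p → sum (λ q → x * f p q + y * g p q)) ≡ x * sum (λ p → sum (f p)) + y * sum (λ p → sum (g p))
sum₂-linear x y f g = trans (sum-cong-≗ λ p → sum-linear x y (f p) (g p))
  (sum-linear x y (λ p → sum (f p)) (λ p → sum (g p)))

sum-sq-gram : ∀ {m d} (v : Vector ℤ m) (u : Fin m → Vector ℤ d) →
  sum (λ S → sum (λ p → v p * u p S) * sum (λ p → v p * u p S)) ≡
  sum (λ p → sum (λ q → v p * v q * sum (λ S → u p S * u q S)))
sum-sq-gram v u = begin-equality
  sum (λ S → sum (λ p → v p * u p S) * sum (λ p → v p * u p S))
    ≡⟨ sum-cong-≗ (λ S → sum-* (λ p → v p * u p S) (λ p → v p * u p S)) ⟩
  sum (λ S → sum (λ p → sum (λ q → v p * u p S * (v q * u q S))))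
    ≡⟨ ∑-comm (λ S p → sum (λ q → v p * u p S * (v q * u q S))) ⟩
  sum (λ p → sum (λ S → sum (λ q → v p * u p S * (v q * u q S))))
    ≡⟨ sum-cong-≗ (λ p → ∑-comm (λ S q → v p * u p S * (v q * u q S))) ⟩
  sum (λ p → sum (λ q → sum (λ S → v p * u p S * (v q * u q S))))
    ≡⟨ sum-cong-≗ (λ p → sum-cong-≗ λ q → trans (sum-cong-≗ λ S → ring (v p) (u p S) (v q) (u q S))
         (sym (*-distribˡ-sum (v p * v q) (λ S → u p S * u q S)))) ⟩
  sum (λ p → sum (λ q → v p * v q * sum (λ S → u p S * u q S))) ∎
  where
  ring : ∀ a b c d → a * b * (c * d) ≡ a * c * (b * d)
  ring = solve-∀

sum-1 : ∀ n → sum {n} (λ _ → 1ℤ) ≡ + n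
sum-1 zero    = refl
sum-1 (suc n) = cong (_+_ 1ℤ) (sum-1 n)

infix 8 _·_
_·_ : ∀ {n} → Vector ℤ n → Vector ℤ n → ℤ
x · y = sum (x ⊙ y)

sign-· : ∀ {n} (x : Vector ℤ n) → IsSign x → x · x ≡ + n
sign-· {n} x x² = trans (sum-cong-≗ x²) (sum-1 n)

sign-⊙ : ∀ {n} (x y : Vector ℤ n) → IsSign x → IsSign y → IsSign (x ⊙ y)
sign-⊙ x y x² y² i = trans (ring (x i) (y i)) (cong₂ _*_ (x² i) (y² i))
  where
  ring : ∀ a b → a * b * (a * b) ≡ a * a * (b * b)
  ring = solve-∀

module _ {m n : ℕ} (a b : ℤ) (X : Fin m → Vector ℤ n) (X² : ∀ p → IsSign (X p))
         (quintic≡0 : ∀ p q → q ≢ p → quintic a b (X p · X q) ≡ 0ℤ) where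

  -- This is `Q_k` of the overview. Written as a sum of squares, it is visibly nonnegative and
  -- vanishes with its linear forms; `energy-esym` recovers the kernel.
  energy : ℕ → Vector ℤ m → ℤ
  energy k v = sum (λ S → sum (λ p → v p * monomials k (X p) S) * sum (λ p → v p * monomials k (X p) S))

  energy-esym : ∀ k v → energy k v ≡ sum (λ p → sum (λ q → v p * v q * esym k (X p ⊙ X q)))
  energy-esym k v = trans (sum-sq-gram v (λ p → monomials k (X p)))
    (sum-cong-≗ λ p → sum-cong-≗ λ q → cong (v p * v q *_) (sum-cong-≗ λ S → sym (monomials-⊙ k (X p) (X q) S)))

  -- The double sum of `v p * v q * quintic a b (X p · X q)` is evaluated twice: by the vanishing
  -- hypothesis only the diagonal survives, and by the expansion it splits into the energies of
  -- degrees 5, 3 and 1.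
  energy-identity : ∀ v → quintic a b (+ n) * sum (λ p → v p * v p) ≡
    + 120 * energy 5 v + (+ 12 * slack (+ n) a b * energy 3 v + denominator (+ n) a b * energy 1 v)
  energy-identity v = begin-equality
    quintic a b (+ n) * sum (λ p → v p * v p)
      ≡⟨ *-distribˡ-sum (quintic a b (+ n)) (λ p → v p * v p) ⟩
    sum (λ p → quintic a b (+ n) * (v p * v p))
      ≡⟨ sum-cong-≗ (λ p → sym (diagonal p)) ⟩
    sum (λ p → sum (λ q → v p * v q * quintic a b (X p · X q)))
      ≡⟨ sum-cong-≗ (λ p → sum-cong-≗ (expand p)) ⟩
    -- The factor `1ℤ` gives the summand the two-term shape of `sum₂-linear`.
    sum (λ p → sum (λ q → + 120 * form 5 p q + 1ℤ * (c₃ * form 3 p q + c₁ * form 1 p q)))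
      ≡⟨ sum₂-linear (+ 120) 1ℤ (form 5) (λ p q → c₃ * form 3 p q + c₁ * form 1 p q) ⟩
    + 120 * sum (λ p → sum (form 5 p)) + 1ℤ * sum (λ p → sum (λ q → c₃ * form 3 p q + c₁ * form 1 p q))
      ≡⟨ cong₂ (λ u w → + 120 * u + w) (sym (energy-esym 5 v)) (*-identityˡ _) ⟩
    + 120 * energy 5 v + sum (λ p → sum (λ q → c₃ * form 3 p q + c₁ * form 1 p q))
      ≡⟨ cong (_+_ (+ 120 * energy 5 v)) (sum₂-linear c₃ c₁ (form 3) (form 1)) ⟩
    + 120 * energy 5 v + (c₃ * sum (λ p → sum (form 3 p)) + c₁ * sum (λ p → sum (form 1 p)))
      ≡⟨ cong₂ (λ u w → + 120 * energy 5 v + (c₃ * u + c₁ * w)) (sym (energy-esym 3 v)) (sym (energy-esym 1 v)) ⟩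
    + 120 * energy 5 v + (c₃ * energy 3 v + c₁ * energy 1 v) ∎
    where
    c₁ c₃ : ℤ
    c₁ = denominator (+ n) a b
    c₃ = + 12 * slack (+ n) a b

    form : ℕ → Fin m → Vector ℤ m
    form k p q = v p * v q * esym k (X p ⊙ X q)

    diagonal : ∀ p → sum (λ q → v p * v q * quintic a b (X p · X q)) ≡ quintic a b (+ n) * (v p * v p)
    diagonal p = trans
      (sum-single (λ q → v p * v q * quintic a b (X p · X q)) p
        λ q q≢p → trans (cong (v p * v q *_) (quintic≡0 p q q≢p)) (*-zeroʳ (v p * v q)))
      (trans (cong (λ t → v p * v p * quintic a b t) (sign-· (X p) (X² p))) (*-comm (v p * v p) (quintic a b (+ n))))

    expand : ∀ p q → v p * v q * quintic a b (X p · X q) ≡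
                     + 120 * form 5 p q + 1ℤ * (c₃ * form 3 p q + c₁ * form 1 p q)
    expand p q = trans
      (cong (v p * v q *_) (quintic-expansion a b (X p ⊙ X q) (sign-⊙ (X p) (X q) (X² p) (X² q))))
      (ring (v p * v q) c₃ c₁ (esym 5 (X p ⊙ X q)) (esym 3 (X p ⊙ X q)) (esym 1 (X p ⊙ X q)))
      where
      ring : ∀ w c₃ c₁ e₅ e₃ e₁ → w * (+ 120 * e₅ + (c₃ * e₃ + c₁ * e₁)) ≡
             + 120 * (w * e₅) + 1ℤ * (c₃ * (w * e₃) + c₁ * (w * e₁))
      ring = solve-∀

-- Dimension bound and linear programming bound for sign vectors.

0≤i*j : ∀ {i j} → 0ℤ ≤ i → 0ℤ ≤ j → 0ℤ ≤ i * j
0≤i*j {i} {j} 0≤i 0≤j = ≤-trans (≤-reflexive (sym (*-zeroʳ i))) (*-monoˡ-≤-nonNeg i {{nonNegative 0≤i}} 0≤j)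

module _ {m n : ℕ} (a b : ℤ) (X : Fin m → Vector ℤ n) (X² : ∀ p → IsSign (X p))
         (quintic≡0 : ∀ p q → q ≢ p → quintic a b (X p · X q) ≡ 0ℤ) where
  private
    E : ℕ → Vector ℤ m → ℤ
    E = energy a b X X² quintic≡0

  dimension-bound : quintic a b (+ n) ≢ 0ℤ → m ℕ.≤ choose n 1 ℕ.+ (choose n 3 ℕ.+ choose n 5)
  dimension-bound quintic≢0 = ℕ.≮⇒≥ λ d<m → impossible (linear-dependence d<m features)
    where
    features : Fin m → Vector ℤ (choose n 1 ℕ.+ (choose n 3 ℕ.+ choose n 5))
    features p = monomials 1 (X p) ++ (monomials 3 (X p) ++ monomials 5 (X p))

    impossible : ¬ ∃ λ (c : Vector ℤ m) → (∃ λ p → c p ≢ 0ℤ) × (∀ S → sum (λ p → c p * features p S) ≡ 0ℤ)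
    impossible (c , (p , cp≢0) , c⊥) = cp≢0 (sum-sq≡0 c ∑c²≡0 p)
      where
      -- `ι` embeds the degree `k` block into the coordinates of `features`, so the dependence kills
      -- every linear form in `E k c`.
      E≡0 : ∀ k (ι : Fin (choose n k) → Fin (choose n 1 ℕ.+ (choose n 3 ℕ.+ choose n 5))) →
            (∀ p S → features p (ι S) ≡ monomials k (X p) S) → E k c ≡ 0ℤ
      E≡0 k ι ι-lookup = sum≡0 _ λ S → cong (λ t → t * t)
        (trans (sum-cong-≗ λ p → cong (c p *_) (sym (ι-lookup p S))) (c⊥ (ι S)))

      E₁≡0 : E 1 c ≡ 0ℤ
      E₁≡0 = E≡0 1 (_↑ˡ _) λ p → lookup-++ˡ (monomials 1 (X p)) _

      E₃≡0 : E 3 c ≡ 0ℤ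
      E₃≡0 = E≡0 3 (λ S → choose n 1 ↑ʳ (S ↑ˡ _)) λ p S →
        trans (lookup-++ʳ (monomials 1 (X p)) _ (S ↑ˡ _)) (lookup-++ˡ (monomials 3 (X p)) _ S)

      E₅≡0 : E 5 c ≡ 0ℤ
      E₅≡0 = E≡0 5 (λ S → choose n 1 ↑ʳ (choose n 3 ↑ʳ S)) λ p S →
        trans (lookup-++ʳ (monomials 1 (X p)) _ (choose n 3 ↑ʳ S)) (lookup-++ʳ (monomials 3 (X p)) _ S)

      vanish : ∀ x y {e₁ e₃ e₅} → e₁ ≡ 0ℤ → e₃ ≡ 0ℤ → e₅ ≡ 0ℤ → + 120 * e₅ + (x * e₃ + y * e₁) ≡ 0ℤ
      vanish x y refl refl refl = cong (_+_ 0ℤ) (cong₂ _+_ (*-zeroʳ x) (*-zeroʳ y))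

      ∑c²≡0 : sum (λ p → c p * c p) ≡ 0ℤ
      ∑c²≡0 = [ (λ eq → contradiction eq quintic≢0) , id ]
        (i*j≡0⇒i≡0∨j≡0 (quintic a b (+ n)) (trans (energy-identity a b X X² quintic≡0 c)
          (vanish (+ 12 * slack (+ n) a b) (denominator (+ n) a b) E₁≡0 E₃≡0 E₅≡0)))

-- The test vector is the first coordinate of the X p; for rows of Hadamard matrices it is an eigenvector of the
-- Gram matrix, so nothing is lost.
linear-programming-bound : ∀ {m n} .{{_ : NonZero n}} a b (X : Fin m → Vector ℤ n) → (∀ p → IsSign (X p)) →
  (∀ p q → q ≢ p → quintic a b (X p · X q) ≡ 0ℤ) →
  0ℤ ≤ slack (+ n) a b → 0ℤ ≤ denominator (+ n) a b →
  denominator (+ n) a b * (+ m * + m) ≤ quintic a b (+ n) * + m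
linear-programming-bound {m} {suc n} a b X X² quintic≡0 0≤slack 0≤den = begin
  den * (+ m * + m)
    ≤⟨ *-monoˡ-≤-nonNeg den {{nonNegative 0≤den}} m²≤E₁ ⟩
  den * E 1
    ≡⟨ sym (trans (+-identityˡ _) (+-identityˡ _)) ⟩
  0ℤ + (0ℤ + den * E 1)
    -- The energies of degrees 5 and 3 have nonnegative coefficients, the latter by `0≤slack`, and
    -- are discarded.
    ≤⟨ +-mono-≤ (0≤i*j {+ 120} (+≤+ ℕ.z≤n) (0≤E 5))
         (+-monoˡ-≤ (den * E 1) (0≤i*j (0≤i*j {+ 12} (+≤+ ℕ.z≤n) 0≤slack) (0≤E 3))) ⟩
  + 120 * E 5 + (+ 12 * slack (+ suc n) a b * E 3 + den * E 1)
    ≡⟨ sym (energy-identity a b X X² quintic≡0 v) ⟩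
  quintic a b (+ suc n) * sum (λ p → v p * v p)
    ≡⟨ cong (quintic a b (+ suc n) *_) ∑v² ⟩
  quintic a b (+ suc n) * + m ∎
  where
  den : ℤ
  den = denominator (+ suc n) a b

  v : Vector ℤ m
  v p = X p zero

  E : ℕ → ℤ
  E k = energy a b X X² quintic≡0 k v

  0≤E : ∀ k → 0ℤ ≤ E k
  0≤E k = 0≤sum-sq (λ S → sum (λ p → v p * monomials k (X p) S))

  ∑v² : sum (λ p → v p * v p) ≡ + m
  ∑v² = trans (sum-cong-≗ λ p → X² p zero) (sum-1 m)

  -- Of the squares in `E 1` only the one for coordinate `zero` is kept; its linear form takes the
  -- value `∑v²`.
  m²≤E₁ : + m * + m ≤ E 1
  m²≤E₁ = ≤-trans (≤-reflexive (cong (λ t → t * t) (sym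
      (trans (sum-cong-≗ λ p → cong (v p *_) (*-identityʳ (v p))) ∑v²))))
    (sq≤sum-sq (λ S → sum (λ p → v p * monomials 1 (X p) S)) zero)

-- Binomial coefficients and the quartic bound.

-- Count pairs of a `k`-subset and a point: the point lies outside, giving a marked subset of size
-- `k + 1`, or inside. Formally this is an induction along Pascal's rule.
choose-absorption : ∀ n k → + suc k * + choose n (suc k) + + k * + choose n k ≡ + n * + choose n k
choose-absorption zero    zero    = refl
choose-absorption zero    (suc k) = cong₂ _+_ (*-zeroʳ (+ suc (suc k))) (*-zeroʳ (+ suc k))
choose-absorption (suc n) zero    = begin-equality
  1ℤ * (1ℤ + c₁) + 0ℤ            ≡⟨ ring c₁ ⟩
  1ℤ + (1ℤ * c₁ + 0ℤ * 1ℤ)       ≡⟨ cong (_+_ 1ℤ) (choose-absorption n 0) ⟩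
  1ℤ + + n * 1ℤ                  ≡⟨ ring′ (+ n) ⟩
  (1ℤ + + n) * 1ℤ                ∎
  where
  c₁ = + choose n 1
  ring : ∀ c → 1ℤ * (1ℤ + c) + 0ℤ ≡ 1ℤ + (1ℤ * c + 0ℤ * 1ℤ)
  ring = solve-∀
  ring′ : ∀ n → 1ℤ + n * 1ℤ ≡ (1ℤ + n) * 1ℤ
  ring′ = solve-∀
choose-absorption (suc n) (suc k) = begin-equality
  (+ 2 + + k) * (c₁ + c₂) + (1ℤ + + k) * (c₀ + c₁)
    ≡⟨ ring (+ k) c₀ c₁ c₂ ⟩
  ((+ 2 + + k) * c₂ + (1ℤ + + k) * c₁) + ((1ℤ + + k) * c₁ + + k * c₀) + (c₀ + c₁)
    ≡⟨ cong (_+ (c₀ + c₁)) (cong₂ _+_ (choose-absorption n (suc k)) (choose-absorption n k)) ⟩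
  + n * c₁ + + n * c₀ + (c₀ + c₁)
    ≡⟨ ring′ (+ n) c₀ c₁ ⟩
  (1ℤ + + n) * (c₀ + c₁) ∎
  where
  c₀ = + choose n k
  c₁ = + choose n (suc k)
  c₂ = + choose n (suc (suc k))
  ring : ∀ k c₀ c₁ c₂ → (+ 2 + k) * (c₁ + c₂) + (1ℤ + k) * (c₀ + c₁) ≡
    ((+ 2 + k) * c₂ + (1ℤ + k) * c₁) + ((1ℤ + k) * c₁ + k * c₀) + (c₀ + c₁)
  ring = solve-∀
  ring′ : ∀ n c₀ c₁ → n * c₁ + n * c₀ + (c₀ + c₁) ≡ (1ℤ + n) * (c₀ + c₁)
  ring′ = solve-∀

choose-1 : ∀ n → choose n 1 ≡ n
choose-1 zero    = refl
choose-1 (suc n) = cong suc (choose-1 n)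

-- The absorption relations for `k` from 1 to 4 determine the binomials as polynomials in `n`. The
-- factor 120 clears the denominators.
choose-1+3+5 : ∀ n → + 120 * + (choose n 1 ℕ.+ (choose n 3 ℕ.+ choose n 5)) ≡
  ((+ n) ^ 4 - (+ 10) * (+ n) ^ 3 + (+ 55) * (+ n) ^ 2 - (+ 110) * (+ n) + (+ 184)) * + n
choose-1+3+5 n = begin-equality
  + 120 * (+ choose n 1 + (c₃ + c₅))
    ≡⟨ cong (λ c → + 120 * (+ c + (c₃ + c₅))) (choose-1 n) ⟩
  + 120 * (+ n + (c₃ + c₅))
    ≡⟨ ring (+ n) c₂ c₃ c₄ c₅ ⟩
  rhs - (d₂ * residual 1 c₂ (+ n) + d₃ * residual 2 c₃ c₂ + d₄ * residual 3 c₄ c₃ + d₅ * residual 4 c₅ c₄)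
    ≡⟨ subtract-zeros rhs d₂ d₃ d₄ d₅
         (trans (cong (λ c → residual 1 c₂ (+ c)) (sym (choose-1 n))) (residual≡0 1))
         (residual≡0 2) (residual≡0 3) (residual≡0 4) ⟩
  rhs ∎
  where
  c₂ c₃ c₄ c₅ d₂ d₃ d₄ d₅ rhs : ℤ
  c₂ = + choose n 2
  c₃ = + choose n 3
  c₄ = + choose n 4
  c₅ = + choose n 5
  -- Chosen from the top down: `d₅` accounts for `c₅`, then `d₄`, `d₃` and `d₂` for what is left in
  -- `c₄`, `c₃` and `c₂`.
  d₅ = - + 24
  d₄ = - (+ 6 * (+ n - + 4))
  d₃ = - (+ 40 + + 2 * ((+ n - + 4) * (+ n - + 3)))
  d₂ = - ((+ 20 + (+ n - + 4) * (+ n - + 3)) * (+ n - + 2))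
  rhs = ((+ n) ^ 4 - (+ 10) * (+ n) ^ 3 + (+ 55) * (+ n) ^ 2 - (+ 110) * (+ n) + (+ 184)) * + n

  residual : ℕ → ℤ → ℤ → ℤ
  residual k c₁ c₀ = + suc k * c₁ + + k * c₀ - + n * c₀

  residual≡0 : ∀ k → residual k (+ choose n (suc k)) (+ choose n k) ≡ 0ℤ
  residual≡0 k = i≡j⇒i-j≡0 (choose-absorption n k)

  ring : ∀ n c₂ c₃ c₄ c₅ → + 120 * (n + (c₃ + c₅)) ≡
    (n * (n * (n * (n * 1ℤ))) - + 10 * (n * (n * (n * 1ℤ))) + + 55 * (n * (n * 1ℤ)) - + 110 * n + + 184) * n
    - (- ((+ 20 + (n - + 4) * (n - + 3)) * (n - + 2)) * (+ 2 * c₂ + 1ℤ * n - n * n)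
      + - (+ 40 + + 2 * ((n - + 4) * (n - + 3))) * (+ 3 * c₃ + + 2 * c₂ - n * c₂)
      + - (+ 6 * (n - + 4)) * (+ 4 * c₄ + + 3 * c₃ - n * c₃)
      + - + 24 * (+ 5 * c₅ + + 4 * c₄ - n * c₄))
  ring = solve-∀

-- Floor division.

≤-⌊/⌋ : ∀ f N D → 0ℤ < D → + f * D ≤ N → + f ≤ ⌊ N / D ⌋
≤-⌊/⌋ f N (+ zero) (+<+ ()) _
≤-⌊/⌋ f N +[1+ d ] _ fD≤N with N | ≤-trans (≤-reflexive (pos-* f (suc d))) fD≤N
-- `N` bounds a natural number, so it is nonnegative and its floor is that of natural division.
... | + x | +≤+ le = +≤+ (subst (ℕ._≤ x ℕ./ suc d) (m*n/n≡m f (suc d)) (/-monoˡ-≤ (suc d) le))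

-- Rows of Hadamard matrices.

∑≡sum : ∀ {n} (f : Vector ℤ n) → ∑ f ≡ sum f
∑≡sum {zero}  f = refl
∑≡sum {suc n} f = cong (_+_ (f zero)) (∑≡sum (tail f))

hadamard-sign : ∀ {n} {H : Matrix n} → IsHadamard n H → ∀ i → IsSign (H i)
hadamard-sign (±1 , _) i k = [ (λ eq → cong (λ h → h * h) eq) , (λ eq → cong (λ h → h * h) eq) ] (±1 i k)

nδ-≢ : ∀ {n} (i j : Fin n) → i ≢ j → nδ i j ≡ 0ℤ
nδ-≢ i j i≢j with i Fin.≟ j
... | yes i≡j = contradiction i≡j i≢j
... | no  _   = refl

hadamard-orthogonal : ∀ {n} {H : Matrix n} → IsHadamard n H → ∀ i j → i ≢ j → H i · H j ≡ 0ℤ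
hadamard-orthogonal {H = H} (_ , HHᵀ) i j i≢j = trans (sym (∑≡sum (H i ⊙ H j))) (trans (HHᵀ i j) (nδ-≢ i j i≢j))

-- Carrying the sign as an integer `ε` of square 1 lets both signs share one ring computation.
∣i∣≡n⇒i≡±n : ∀ {i n} → ∣ i ∣ ≡ n → ∃ λ ε → ε * ε ≡ 1ℤ × i ≡ ε * + n
∣i∣≡n⇒i≡±n {i} refl with +∣i∣≡i⊎+∣i∣≡-i i
... | inj₁ eq = 1ℤ , refl , trans (sym eq) (sym (*-identityˡ (+ ∣ i ∣)))
... | inj₂ eq = - 1ℤ , refl , trans (sym (neg-involutive i)) (trans (cong -_ (sym eq)) (sym (-1*i≡-i (+ ∣ i ∣))))

-- Equality case of Cauchy-Schwarz: the squared length of `x - ε y` is `2n - 2ε (x · y)`, which is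
-- zero.
sign-collinear : ∀ {n} (x y : Vector ℤ n) ε → IsSign x → IsSign y → ε * ε ≡ 1ℤ →
                 x · y ≡ ε * + n → ∀ i → x i ≡ ε * y i
sign-collinear {n} x y ε x² y² ε² x·y i = i-j≡0⇒i≡j (x i) (ε * y i) (sum-sq≡0 (λ i → x i - ε * y i) ∣x-εy∣²≡0 i)
  where
  ∣x-εy∣²≡0 : sum (λ i → (x i - ε * y i) * (x i - ε * y i)) ≡ 0ℤ
  ∣x-εy∣²≡0 = begin-equality
    sum (λ i → (x i - ε * y i) * (x i - ε * y i))
      ≡⟨ sum-cong-≗ (λ i → trans (ring (x i) (y i) ε)
           (cong₂ (λ u w → u + w + - (+ 2 * ε) * (x i * y i)) (x² i) (cong₂ _*_ ε² (y² i)))) ⟩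
    sum (λ i → + 2 * 1ℤ + - (+ 2 * ε) * (x i * y i))
      ≡⟨ sum-linear (+ 2) (- (+ 2 * ε)) (λ _ → 1ℤ) (x ⊙ y) ⟩
    + 2 * sum {n} (λ _ → 1ℤ) + - (+ 2 * ε) * x · y
      ≡⟨ cong₂ (λ u w → + 2 * u + - (+ 2 * ε) * w) (sum-1 n) x·y ⟩
    + 2 * + n + - (+ 2 * ε) * (ε * + n)
      ≡⟨ ring′ (+ n) ε ⟩
    + 2 * + n + - (+ 2) * (ε * ε * + n)
      ≡⟨ cong (λ u → + 2 * + n + - (+ 2) * (u * + n)) ε² ⟩
    + 2 * + n + - (+ 2) * (1ℤ * + n)
      ≡⟨ ring″ (+ n) ⟩
    0ℤ ∎
    where
    ring : ∀ x y ε → (x - ε * y) * (x - ε * y) ≡ x * x + ε * ε * (y * y) + - (+ 2 * ε) * (x * y)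
    ring = solve-∀
    ring′ : ∀ n ε → + 2 * n + - (+ 2 * ε) * (ε * n) ≡ + 2 * n + - (+ 2) * (ε * ε * n)
    ring′ = solve-∀
    ring″ : ∀ n → + 2 * n + - (+ 2) * (1ℤ * n) ≡ 0ℤ
    ring″ = solve-∀

-- A row of H meeting a row of K in ±n is ± that row of K, so it is orthogonal to the other rows of K.
attained-n : ∀ {m} {H K : Matrix (2 ℕ.+ m)} → IsHadamard _ H → IsHadamard _ K →
             (2 ℕ.+ m) ∈σ[ H , K ] → 0 ∈σ[ H , K ]
attained-n {m} {H} {K} hadH hadK (i , j , eq) with ∣i∣≡n⇒i≡±n {prodT H K i j} eq
... | ε , ε² , t≡εn = i , j′ , cong ∣_∣ (begin-equality
  prodT H K i j′               ≡⟨ ∑≡sum (H i ⊙ K j′) ⟩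
  H i · K j′                   ≡⟨ sum-cong-≗ (λ k → trans (cong (_* K j′ k) (H≡εK k)) (*-assoc ε (K j k) (K j′ k))) ⟩
  sum (λ k → ε * (K j k * K j′ k)) ≡⟨ sym (*-distribˡ-sum ε (K j ⊙ K j′)) ⟩
  ε * K j · K j′               ≡⟨ cong (ε *_) (hadamard-orthogonal {H = K} hadK j j′ j≢j′) ⟩
  ε * 0ℤ                       ≡⟨ *-zeroʳ ε ⟩
  0ℤ                           ∎)
  where
  j′ : Fin (2 ℕ.+ m)
  -- Any row other than `j` would do; one exists because the order is at least 2.
  j′ = punchIn j zero

  j≢j′ : j ≢ j′
  j≢j′ = punchInᵢ≢i j zero ∘ sym

  H≡εK : ∀ k → H i k ≡ ε * K j k
  H≡εK = sign-collinear (H i) (K j) ε (hadamard-sign {H = H} hadH i) (hadamard-sign {H = K} hadK j) ε²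
    (trans (sym (∑≡sum (H i ⊙ K j))) t≡εn)

-- Zeros of the quintic.

quintic-at-0 : ∀ a b t → t ≡ 0ℤ → quintic a b t ≡ 0ℤ
quintic-at-0 a b _ refl = refl

quintic-at-2a : ∀ a b t → ∣ t ∣ ≡ 2 ℕ.* a → quintic (+ a) (+ b) t ≡ 0ℤ
quintic-at-2a a b t eq with ∣i∣≡n⇒i≡±n {t} eq
... | ε , ε² , refl = begin-equality
  quintic (+ a) (+ b) (ε * + (2 ℕ.* a))
    ≡⟨ cong (λ c → quintic (+ a) (+ b) (ε * c)) (pos-* 2 a) ⟩
  quintic (+ a) (+ b) (ε * (+ 2 * + a))
    -- At `ε * 2a` the first quadratic factor is `4 (ε² - 1) a²`, which vanishes.
    ≡⟨ ring ε (+ a) (+ b) ⟩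
  ε * (+ 2 * + a) * (+ 4 * ((ε * ε - 1ℤ) * (+ a * + a)) * r)
    ≡⟨ cong (λ u → ε * (+ 2 * + a) * (+ 4 * ((u - 1ℤ) * (+ a * + a)) * r)) ε² ⟩
  ε * (+ 2 * + a) * 0ℤ
    ≡⟨ *-zeroʳ (ε * (+ 2 * + a)) ⟩
  0ℤ ∎
  where
  r = ε * (+ 2 * + a) * (ε * (+ 2 * + a)) - + 4 * (+ b * + b)
  ring : ∀ ε a b →
    ε * (+ 2 * a) * ((ε * (+ 2 * a) * (ε * (+ 2 * a)) - + 4 * (a * a)) * (ε * (+ 2 * a) * (ε * (+ 2 * a)) - + 4 * (b * b)))
    ≡ ε * (+ 2 * a) * (+ 4 * ((ε * ε - 1ℤ) * (a * a)) * (ε * (+ 2 * a) * (ε * (+ 2 * a)) - + 4 * (b * b)))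
  ring = solve-∀

quintic-sym : ∀ a b t → quintic a b t ≡ quintic b a t
quintic-sym a b t = cong (t *_) (*-comm (t * t - + 4 * (a * a)) (t * t - + 4 * (b * b)))

-- Each quadratic factor splits as `(n - 2c) (n + 2c)`, and `n + 2c` is positive.
quintic≢0 : ∀ n .{{_ : NonZero n}} a b → n ≢ 2 ℕ.* a → n ≢ 2 ℕ.* b → quintic (+ a) (+ b) (+ n) ≢ 0ℤ
quintic≢0 (suc n) a b n≢2a n≢2b eq with i*j≡0⇒i≡0∨j≡0 (+ suc n) eq
... | inj₂ eq′ = [ factor≢0 a n≢2a , factor≢0 b n≢2b ] (i*j≡0⇒i≡0∨j≡0 (+ suc n * + suc n - + 4 * (+ a * + a)) eq′)
  where
  factor≢0 : ∀ c → suc n ≢ 2 ℕ.* c → + suc n * + suc n - + 4 * (+ c * + c) ≢ 0ℤ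
  factor≢0 c n≢2c eq with i*j≡0⇒i≡0∨j≡0 (+ suc n - + 2 * + c) {+ suc n + + 2 * + c} (trans (ring (+ suc n) (+ c)) eq)
    where
    ring : ∀ n c → (n - + 2 * c) * (n + + 2 * c) ≡ n * n - + 4 * (c * c)
    ring = solve-∀
  ... | inj₁ d≡0 = n≢2c (+-injective (trans (i-j≡0⇒i≡j (+ suc n) (+ 2 * + c) d≡0) (sym (pos-* 2 c))))
  ... | inj₂ s≡0 with trans (cong (_+_ (+ suc n)) (pos-* 2 c)) s≡0
  ... | ()

-- Both bounds for the rows of the family.

rows : ∀ {f n} → (Fin f → Matrix n) → Fin (f ℕ.* n) → Vector ℤ n
rows {f} {n} H p = H (Fin.quotient {f} n p) (Fin.remainder {f} n p)

module _ {n f : ℕ} (a b : ℕ) (H : Fin f → Matrix n) (hadamard : ∀ i → IsHadamard n (H i))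
         (σ : ∀ i j → i ≢ j → σ≡[ H i , H j ] (2 ℕ.* a) (2 ℕ.* b)) where

  rows-sign : ∀ p → IsSign (rows H p)
  rows-sign p = hadamard-sign {H = H (Fin.quotient {f} n p)} (hadamard (Fin.quotient {f} n p)) (Fin.remainder {f} n p)

  -- Orthogonality inside one matrix gives the root 0; between two matrices `σ` leaves only the
  -- roots ±2a and ±2b.
  quintic≡0 : ∀ i j r s → (i ≡ j → r ≢ s) → quintic (+ a) (+ b) (H i r · H j s) ≡ 0ℤ
  quintic≡0 i j r s distinct with i Fin.≟ j
  ... | yes refl = quintic-at-0 (+ a) (+ b) (H i r · H i s)
        (hadamard-orthogonal {H = H i} (hadamard i) r s (distinct refl))
  ... | no i≢j with Equivalence.to (σ i j i≢j (∣ H i r · H j s ∣)) (r , s , cong ∣_∣ (∑≡sum (H i r ⊙ H j s)))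
  ... | inj₁ eq = quintic-at-2a a b (H i r · H j s) eq
  ... | inj₂ eq = trans (quintic-sym (+ a) (+ b) (H i r · H j s)) (quintic-at-2a b a (H i r · H j s) eq)

  rows-quintic≡0 : ∀ p q → q ≢ p → quintic (+ a) (+ b) (rows H p · rows H q) ≡ 0ℤ
  rows-quintic≡0 p q q≢p =
    quintic≡0 (Fin.quotient {f} n p) (Fin.quotient {f} n q) (Fin.remainder {f} n p) (Fin.remainder {f} n q)
      λ i≡j r≡s → q≢p (trans (sym (combine-remQuot {f} n q))
        (trans (cong₂ Fin.combine (sym i≡j) (sym r≡s)) (combine-remQuot {f} n p)))

-- `attained-n` needs a second row. In orders 0 and 1 the order is itself one of the two excluded
-- values.
order∉σ : ∀ n {H K : Matrix n} → IsHadamard n H → IsHadamard n K →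
          ¬ (0 ∈σ[ H , K ]) → ¬ (1 ∈σ[ H , K ]) → ¬ (n ∈σ[ H , K ])
order∉σ zero                  hadH hadK 0∉σ 1∉σ = 0∉σ
order∉σ (suc zero)            hadH hadK 0∉σ 1∉σ = 1∉σ
order∉σ (suc (suc n)) {H} {K} hadH hadK 0∉σ 1∉σ = λ n∈σ → 0∉σ (attained-n {H = H} {K} hadH hadK n∈σ)

0≢2* : ∀ a .{{_ : NonZero a}} → 0 ≢ 2 ℕ.* a
0≢2* (suc a) ()

dimension-bound-rows : ∀ {n} .{{_ : NonZero n}} a b f .{{_ : NonZero a}} .{{_ : NonZero b}} (H : Fin f → Matrix n) →
  (∀ i → IsHadamard n (H i)) → (∀ i j → i ≢ j → σ≡[ H i , H j ] (2 ℕ.* a) (2 ℕ.* b)) →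
  f ℕ.* n ℕ.≤ choose n 1 ℕ.+ (choose n 3 ℕ.+ choose n 5)
dimension-bound-rows         a b zero          H hadamard σ = ℕ.z≤n
-- A single member does not relate `n` to `a` and `b`, so the quintic may vanish at `n`; its `n`
-- rows already fit in `choose n 1`.
dimension-bound-rows {n}     a b (suc zero)    H hadamard σ = ℕ.≤-trans
  (ℕ.≤-reflexive (trans (ℕ.*-identityˡ n) (sym (choose-1 n)))) (ℕ.m≤m+n (choose n 1) _)
dimension-bound-rows {n}     a b (suc (suc f)) H hadamard σ =
  dimension-bound (+ a) (+ b) (rows H) (rows-sign a b H hadamard σ) (rows-quintic≡0 a b H hadamard σ)
    (quintic≢0 n a b (≢n (inj₁ refl)) (≢n (inj₂ refl)))
  where
  σ₀₁ : σ≡[ H zero , H (suc zero) ] (2 ℕ.* a) (2 ℕ.* b)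
  σ₀₁ = σ zero (suc zero) λ ()

  0∉σ : ¬ (0 ∈σ[ H zero , H (suc zero) ])
  0∉σ 0∈σ = [ 0≢2* a , 0≢2* b ] (Equivalence.to (σ₀₁ 0) 0∈σ)

  1∉σ : ¬ (1 ∈σ[ H zero , H (suc zero) ])
  1∉σ 1∈σ = [ ℕ.even≢odd a 0 ∘ sym , ℕ.even≢odd b 0 ∘ sym ] (Equivalence.to (σ₀₁ 1) 1∈σ)

  -- This uses that both values in `σ` are attained: if `n` were `2a` or `2b`, it would be an entry
  -- in absolute value, which forces an entry 0 or 1.
  ≢n : ∀ {x} → (x ≡ 2 ℕ.* a) ⊎ (x ≡ 2 ℕ.* b) → n ≢ x
  ≢n x∈ refl = order∉σ n {H zero} {H (suc zero)} (hadamard zero) (hadamard (suc zero)) 0∉σ 1∉σ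
    (Equivalence.from (σ₀₁ n) x∈)

numerator : ℤ → ℤ → ℤ → ℤ
numerator n a b = (n * n - + 4 * (a * a)) * (n * n - + 4 * (b * b))

positive-+ : ∀ n .{{_ : NonZero n}} → Positive (+ n)
positive-+ (suc n) = _

linear-programming-bound-rows : ∀ {n} .{{_ : NonZero n}} a b f (H : Fin f → Matrix n) →
  (∀ i → IsHadamard n (H i)) → (∀ i j → i ≢ j → σ≡[ H i , H j ] (2 ℕ.* a) (2 ℕ.* b)) →
  0ℤ ≤ slack (+ n) (+ a) (+ b) → 0ℤ ≤ denominator (+ n) (+ a) (+ b) →
  + f * denominator (+ n) (+ a) (+ b) ≤ numerator (+ n) (+ a) (+ b)
-- An empty family says nothing about n, a and b; the sign of the right-hand side comes from a single vector.
linear-programming-bound-rows {n} a b zero H hadamard σ 0≤slack 0≤den =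
  *-cancelˡ-≤-pos 0ℤ (numerator (+ n) (+ a) (+ b)) (+ n) {{positive-+ n}} (begin
    + n * 0ℤ                                    ≡⟨ *-zeroʳ (+ n) ⟩
    0ℤ                                          ≤⟨ 0≤i*j 0≤den (+≤+ ℕ.z≤n) ⟩
    denominator (+ n) (+ a) (+ b) * (1ℤ * 1ℤ)   ≤⟨ linear-programming-bound {1} (+ a) (+ b) (λ _ _ → 1ℤ)
                                                        (λ _ _ → refl) (λ { zero zero 0≢0 → contradiction refl 0≢0 })
                                                        0≤slack 0≤den ⟩
    quintic (+ a) (+ b) (+ n) * 1ℤ              ≡⟨ *-identityʳ (quintic (+ a) (+ b) (+ n)) ⟩
    quintic (+ a) (+ b) (+ n)                   ∎)
linear-programming-bound-rows {n} a b (suc f) H hadamard σ 0≤slack 0≤den =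
  *-cancelˡ-≤-pos (+ suc f * den) P (+ n) {{positive-+ n}}
  -- `quintic` at `n` is `n * P`, and one factor `N` is `f * n` with `f` the number of members;
  -- cancelling `N` and then `n` leaves the claim.
  (*-cancelʳ-≤-pos (+ n * (+ suc f * den)) (+ n * P) N {{positive-+ (suc f ℕ.* n) {{ℕ.m*n≢0 (suc f) n}}}} (begin
    + n * (+ suc f * den) * N       ≡⟨ ring (+ n) (+ suc f) den N ⟩
    den * (+ suc f * + n * N)       ≡⟨ cong (λ k → den * (k * N)) (sym (pos-* (suc f) n)) ⟩
    den * (N * N)                   ≤⟨ linear-programming-bound (+ a) (+ b) (rows H)
                                         (rows-sign a b H hadamard σ) (rows-quintic≡0 a b H hadamard σ) 0≤slack 0≤den ⟩
    + n * P * N                     ∎))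
  where
  N P den : ℤ
  N   = + (suc f ℕ.* n)
  P   = numerator (+ n) (+ a) (+ b)
  den = denominator (+ n) (+ a) (+ b)
  ring : ∀ n f d N → n * (f * d) * N ≡ d * (f * n * N)
  ring = solve-∀

-- Agreement with the polynomials as stated, and the conclusion.

quartic : ℤ → ℤ
quartic n = n ^ 4 - (+ 10) * n ^ 3 + (+ 55) * n ^ 2 - (+ 110) * n + (+ 184)

-- Powers with literal exponents compute to products ending in `1ℤ`, so the solved identity `ring`
-- has the required type definitionally.
numerator-^ : ∀ n a b → (n ^ 2 - (+ 4) * a ^ 2) * (n ^ 2 - (+ 4) * b ^ 2) ≡ numerator n a b
numerator-^ = ring
  where
  ring : ∀ n a b → (n * (n * 1ℤ) - + 4 * (a * (a * 1ℤ))) * (n * (n * 1ℤ) - + 4 * (b * (b * 1ℤ))) ≡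
                   (n * n - + 4 * (a * a)) * (n * n - + 4 * (b * b))
  ring = solve-∀

denominator-^ : ∀ n a b → (+ 15) * n ^ 2 - (+ 30) * n + (+ 16) - (+ 4) * ((+ 3) * n - (+ 2)) * (a ^ 2 + b ^ 2)
                          + (+ 16) * a ^ 2 * b ^ 2 ≡ denominator n a b
denominator-^ = ring
  where
  ring : ∀ n a b → + 15 * (n * (n * 1ℤ)) - + 30 * n + + 16
      - + 4 * (+ 3 * n - + 2) * (a * (a * 1ℤ) + b * (b * 1ℤ)) + + 16 * (a * (a * 1ℤ)) * (b * (b * 1ℤ)) ≡
      + 15 * (n * n) - + 30 * n + + 16 - + 4 * (+ 3 * n - + 2) * (a * a + b * b) + + 16 * (a * a) * (b * b)
  ring = solve-∀

slack-^ : ∀ n a b → (+ 5) * (n - (+ 2)) - (+ 2) * a ^ 2 - (+ 2) * b ^ 2 ≡ slack n a b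
slack-^ = ring
  where
  ring : ∀ n a b → + 5 * (n - + 2) - + 2 * (a * (a * 1ℤ)) - + 2 * (b * (b * 1ℤ)) ≡
                   + 5 * (n - + 2) - + 2 * (a * a) - + 2 * (b * b)
  ring = solve-∀

theorem8p6 : (n a b f : ℕ) → .{{NonZero n}} → .{{NonZero a}} → .{{NonZero b}} →
    (H : Fin f → Matrix n) →
    (∀ i → IsHadamard n (H i)) →
    (∀ i j → i ≢ j → TypeIIWU n (H i) (H j)) →
    (∀ i j → i ≢ j → σ≡[ H i , H j ] (2 Data.Nat.* a) (2 Data.Nat.* b)) →
    ((+ f) ≤ ⌊ (+ n) ^ 4 - (+ 10) * (+ n) ^ 3 + (+ 55) * (+ n) ^ 2 - (+ 110) * (+ n) + (+ 184) / + 120 ⌋)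
    × ((+ 0) < (+ 15) * (+ n) ^ 2 - (+ 30) * (+ n) + (+ 16) - (+ 4) * ((+ 3) * (+ n) - (+ 2)) * ((+ a) ^ 2 + (+ b) ^ 2) + (+ 16) * (+ a) ^ 2 * (+ b) ^ 2 →
    (+ 0) ≤ (+ 5) * ((+ n) - (+ 2)) - (+ 2) * (+ a) ^ 2 - (+ 2) * (+ b) ^ 2 →
    (+ f) ≤ ⌊ ((+ n) ^ 2 - (+ 4) * (+ a) ^ 2) * ((+ n) ^ 2 - (+ 4) * (+ b) ^ 2) / (+ 15) * (+ n) ^ 2 - (+ 30) * (+ n) + (+ 16) - (+ 4) * ((+ 3) * (+ n) - (+ 2)) * ((+ a) ^ 2 + (+ b) ^ 2) + (+ 16) * (+ a) ^ 2 * (+ b) ^ 2 ⌋)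
theorem8p6 n a b f H hadamard _ σ = part-i , part-ii
  where
  part-i = ≤-⌊/⌋ f (quartic (+ n)) (+ 120) (+<+ (ℕ.s≤s ℕ.z≤n))
    -- The dimension bound concerns `f * n` rows; after multiplication by 5! both sides carry a
    -- factor `n`, which is cancelled.
    (*-cancelʳ-≤-pos (+ f * + 120) (quartic (+ n)) (+ n) {{positive-+ n}} (begin
    + f * + 120 * + n
      ≡⟨ ring (+ f) (+ 120) (+ n) ⟩
    + 120 * (+ f * + n)
      ≡⟨ cong (+ 120 *_) (sym (pos-* f n)) ⟩
    + 120 * + (f ℕ.* n)
      ≤⟨ *-monoˡ-≤-nonNeg (+ 120) (+≤+ (dimension-bound-rows a b f H hadamard σ)) ⟩
    + 120 * + (choose n 1 ℕ.+ (choose n 3 ℕ.+ choose n 5))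
      ≡⟨ choose-1+3+5 n ⟩
    quartic (+ n) * + n ∎))
    where
    ring : ∀ x c y → x * c * y ≡ c * (x * y)
    ring = solve-∀

  part-ii = λ 0<den 0≤slack → ≤-⌊/⌋ f _ _ 0<den (subst₂ (λ N D → + f * D ≤ N)
    (sym (numerator-^ (+ n) (+ a) (+ b))) (sym (denominator-^ (+ n) (+ a) (+ b)))
    (linear-programming-bound-rows a b f H hadamard σ
      (subst (0ℤ ≤_) (slack-^ (+ n) (+ a) (+ b)) 0≤slack)
      (subst (0ℤ ≤_) (denominator-^ (+ n) (+ a) (+ b)) (<⇒≤ 0<den))))
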